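{- For every field $\mathbb F$, $\mathcal S_{\mathbf{IM}(\mathbb F)}\simeq\mathcal S_{\mathbf{IMt}(\mathbb F)}$.
   Context: All sets are finite. $[k]=\{1,\dots,k\}$; $[k]^{(2)}$ is the set of pairs of distinct elements of $[k]$. A labelled partition of $A$ is a function $\gamma:A\to L$; $\mathcal P(A)$ is the class of these. $\gamma\preceq\rho$ means $\rho(a)=\rho(b)\Rightarrow\gamma(a)=\gamma(b)$; $\gamma\approx\rho$ means both directions. For $\vec v\in V^k$, $\vec i\in[k]^{(2)}$, $(x,y)\in V^2$, $\vec v\langle\vec i,(x,y)\rangle$ is $\vec v$ with $x$ in position $i_1$ and $y$ in position $i_2$. $\mathrm{pr}_t\gamma(w_1,\dots,w_t)=\gamma(w_1,\dots,w_t,w_t,\dots,w_t)$. A graph on $V$ is a labelled partition $\Gamma$ of $V^2$; $\alpha_{k,\Gamma}(\vec v)=(\Gamma(v_i,v_j))_{(i,j)\in[k]^{(2)}}$. A $k$-refinement operator $R$ maps each $\gamma\in\mathcal P(V^k)$ (any finite $V$) to $R\circ\gamma\in\mathcal P(V^k)$ with $\gamma\preceq R\circ\gamma$; $\gamma$ is $R$-stable if $\gamma\approx R\circ\gamma$; $[\gamma]^R$ is the first $R$-stable term of $X^0=\gamma$, $X^i=R\circ X^{i-1}$. For $\mathbf R=\{R_1,R_2,\dots\}$: $\overline R_1(\Gamma)=\Gamma$, $\overline R_k(\Gamma)=\mathrm{pr}_2[\alpha_{k,\Gamma}]^{R_k}$ ($k\ge2$), $\mathcal S_{\mathbf R}=\{\overline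 R_1,\overline R_2,\dots\}$. $\mathrm{IM}^{\mathbb F}_k\circ\gamma=\mathrm{IMt}^{\mathbb F}_k\circ\gamma=\gamma$ for $k\le2$. For $k>2$: for $\vec i\in[k]^{(2)}$, $\sigma\in\mathrm{Im}(\gamma)$ let $\chi^{\gamma,\vec v}_{\vec i,\sigma}\in\mathrm{Mat}_V(\mathbb F)$ have $(x,y)$-entry $1$ iff $\gamma(\vec v\langle\vec i,(x,y)\rangle)=\sigma$ (else $0$); $\mathrm{IM}^{\mathbb F}_k\circ\gamma(\vec u)=\mathrm{IM}^{\mathbb F}_k\circ\gamma(\vec v)$ iff $\gamma(\vec u)=\gamma(\vec v)$ and for each $\vec i\in[k]^{(2)}$ there is $S\in\mathrm{GL}_V(\mathbb F)$ with $S\chi^{\gamma,\vec u}_{\vec i,\sigma}S^{ -1}=\chi^{\gamma,\vec v}_{\vec i,\sigma}$ for all $\sigma$. For $\vec\phi\in\mathrm{Im}(\gamma)^{[k]^{(2)}}$ let $\chi^{\gamma,\vec v}_{\vec\phi}$ have $(x,y)$-entry $1$ iff $\gamma(\vec v\langle\vec i,(x,y)\rangle)=\phi_{\vec i}$ for all $\vec i\in[k]^{(2)}$; $\mathrm{IMt}^{\mathbb F}_k\circ\gamma(\vec u)=\mathrm{IMt}^{\mathbb F}_k\circ\gamma(\vec v)$ iff $\gamma(\vec u)=\gamma(\vec v)$ and there is a single $S\in\mathrm{GL}_V(\mathbb F)$ with $S\chi^{\gamma,\vec u}_{\vec\phi}S^{ -1}=\chi^{\gamma,\vec v}_{\vec\phi}$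 for all $\vec\phi$. $\mathcal S_{\mathbf{IM}(\mathbb F)}$ and $\mathcal S_{\mathbf{IMt}(\mathbb F)}$ are the schemes obtained from $\{\mathrm{IM}^{\mathbb F}_k\}_k$ and $\{\mathrm{IMt}^{\mathbb F}_k\}_k$. For schemes $\mathcal S_X=\{X_k\}$, $\mathcal S_Y=\{Y_k\}$: $\mathcal S_Y\preceq\mathcal S_X$ if for every $k$ there is $k'$ with $Y_k(\Gamma)\preceq X_{k'}(\Gamma)$ for all graphs $\Gamma$; $\mathcal S_X\simeq\mathcal S_Y$ if both directions hold. -}

module Defs where

open import Level using (Level; _⊔_; suc; 0ℓ)
open import Algebra.Bundles using (CommutativeRing)
open import Data.Nat as ℕ using (ℕ; _≤_)
open import Data.Fin as Fin using (Fin; toℕ)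
open import Data.Fin.Properties as FinP using (all?)
open import Data.Vec as Vec using (Vec; tabulate)
import Data.Vec.Properties as VecP
open import Data.Maybe using (Maybe; just; nothing)
import Data.Maybe.Properties as MaybeP
open import Data.Product using (Σ; Σ-syntax; ∃; ∃-syntax; _×_; _,_; proj₁; proj₂)
open import Data.Bool using (Bool; true; false; if_then_else_)
open import Relation.Nullary using (¬_; Dec; yes; no; does)
open import Relation.Binary.PropositionalEquality using (_≡_; _≢_)
open import Relation.Binary.Definitions using (DecidableEquality)
open import Function.Bundles using (_⇔_)
open import Data.Empty using (⊥-elim)
open import Relation.Nullary.Decidable using (map′)

record Field (c ℓ : Level) : Set (suc (c ⊔ ℓ)) where
  field
    commutativeRing : CommutativeRing c ℓ
  open CommutativeRing commutativeRing public
  field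
    0≉1     : ¬ (0# ≈ 1#)
    inverse : ∀ x → ¬ (x ≈ 0#) → ∃[ y ] (x * y ≈ 1#)

-- Vertex sets: a finite set V is represented by Fin n.
-- V^k = Fin k → Fin n (positions 1..k of the paper are Fin k here).

Tuple : ℕ → ℕ → Set
Tuple n k = Fin k → Fin n

record LPart (n k : ℕ) : Set₁ where
  constructor lpart
  field
    Label  : Set
    _≟L_   : DecidableEquality Label
    label  : Tuple n k → Label
open LPart public

_⪯_ : ∀ {n k} → LPart n k → LPart n k → Set
γ ⪯ ρ = ∀ a b → label ρ a ≡ label ρ b → label γ a ≡ label γ b

InIm : ∀ {n k} (γ : LPart n k) → Label γ → Set
InIm γ σ = ∃[ w ] (label γ w ≡ σ)

subst2 : ∀ {n k} → Tuple n k → Fin k → Fin k → Fin n → Fin n → Tuple n k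
subst2 v i₁ i₂ x y p =
  if does (p Fin.≟ i₁) then x else (if does (p Fin.≟ i₂) then y else v p)

pr₂tuple : ∀ {n k} → Tuple n 2 → Tuple n k
pr₂tuple w p with toℕ p
... | ℕ.zero  = w Fin.zero
... | ℕ.suc _ = w (Fin.suc Fin.zero)

pr₂ : ∀ {n k} → LPart n k → LPart n 2
pr₂ (lpart L d γ) = lpart L d (λ w → γ (pr₂tuple w))

Graph : ℕ → Set₁
Graph n = LPart n 2

pair : ∀ {n} → Fin n → Fin n → Tuple n 2
pair x y Fin.zero    = x
pair x y (Fin.suc _) = y

-- α_{k,Γ}(v) = (Γ(v_i,v_j))_{(i,j) ∈ [k]^(2)}; diagonal positions carry
-- the dummy value 'nothing', so only off-diagonal pairs are recorded.
α : ∀ {n} (k : ℕ) → Graph n → LPart n k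
α k (lpart L d Γ) =
  lpart (Vec (Vec (Maybe L) k) k)
        (VecP.≡-dec (VecP.≡-dec (MaybeP.≡-dec d)))
        (λ v → tabulate λ i → tabulate λ j →
           if does (i Fin.≟ j) then nothing else just (Γ (pair (v i) (v j))))

-- Refinement operators, given by the relation "R∘γ(u) = R∘γ(v)".

RelOp : (a : Level) → Set (suc a)
RelOp a = ∀ {n k} → LPart n k → Tuple n k → Tuple n k → Set a

module Schemes {a} (R : RelOp a) where

  -- γ' is (a choice of labels for) R∘γ
  IsRefinement : ∀ {n k} → LPart n k → LPart n k → Set a
  IsRefinement γ γ' = ∀ u v → (label γ' u ≡ label γ' v) ⇔ R γ u v

  Stable : ∀ {n k} → LPart n k → Set a
  Stable γ = ∀ u v → (label γ u ≡ label γ v) ⇔ R γ u v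

  -- Stabilised γ Z : Z is [γ]^R, the first R-stable term of
  -- X⁰ = γ, X^{i+1} = R∘X^i.
  data Stabilised {n k} : LPart n k → LPart n k → Set (suc 0ℓ ⊔ a) where
    done : ∀ {γ} → Stable γ → Stabilised γ γ
    step : ∀ {γ γ' Z} → ¬ Stable γ → IsRefinement γ γ' → Stabilised γ' Z →
           Stabilised γ Z

  data Scheme {n} : ℕ → Graph n → LPart n 2 → Set (suc 0ℓ ⊔ a) where
    one  : ∀ {Γ} → Scheme 1 Γ Γ
    many : ∀ {k Γ Z} → 2 ≤ k → Stabilised (α k Γ) Z → Scheme k Γ (pr₂ Z)

SchemeLeq : ∀ {a b} → RelOp a → RelOp b → Set (suc 0ℓ ⊔ a ⊔ b)
SchemeLeq Y X =
  ∀ k → 1 ≤ k → ∃[ k' ] (1 ≤ k' ×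
    (∀ n (Γ : Graph n) (P Q : LPart n 2) →
       Schemes.Scheme Y k Γ P → Schemes.Scheme X k' Γ Q → P ⪯ Q))

SchemeEquiv : ∀ {a b} → RelOp a → RelOp b → Set (suc 0ℓ ⊔ a ⊔ b)
SchemeEquiv X Y = SchemeLeq Y X × SchemeLeq X Y

module WithField {c ℓ} (F : Field c ℓ) where
  open Field F

  Mat : ℕ → Set c
  Mat n = Fin n → Fin n → Carrier

  sumF : ∀ {n} → (Fin n → Carrier) → Carrier
  sumF {ℕ.zero}  f = 0#
  sumF {ℕ.suc n} f = f Fin.zero + sumF (λ i → f (Fin.suc i))

  _·_ : ∀ {n} → Mat n → Mat n → Mat n
  (A · B) x y = sumF (λ z → A x z * B z y)

  I : ∀ {n} → Mat n
  I x y = if does (x Fin.≟ y) then 1# else 0#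

  _≈M_ : ∀ {n} → Mat n → Mat n → Set ℓ
  A ≈M B = ∀ x y → A x y ≈ B x y

  IsInverse : ∀ {n} → Mat n → Mat n → Set ℓ
  IsInverse S T = ((S · T) ≈M I) × ((T · S) ≈M I)

  χ : ∀ {n k} (γ : LPart n k) → Tuple n k → Fin k → Fin k → Label γ → Mat n
  χ γ v i₁ i₂ σ x y =
    if does (_≟L_ γ (label γ (subst2 v i₁ i₂ x y)) σ) then 1# else 0#

  matchAll? : ∀ {n k} (γ : LPart n k) (v : Tuple n k)
              (φ : Fin k → Fin k → Label γ) (x y : Fin n) →
              Dec (∀ i j → i ≢ j → label γ (subst2 v i j x y) ≡ φ i j)
  matchAll? γ v φ x y = all? (λ i → all? (λ j → pt i j))
    where
    pt : ∀ i j → Dec (i ≢ j → label γ (subst2 v i j x y) ≡ φ i j)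
    pt i j with i Fin.≟ j
    ... | yes eq = yes (λ ne → ⊥-elim (ne eq))
    ... | no ne  = map′ (λ e _ → e) (λ f → f ne)
                        (_≟L_ γ (label γ (subst2 v i j x y)) (φ i j))

  χt : ∀ {n k} (γ : LPart n k) → Tuple n k → (Fin k → Fin k → Label γ) → Mat n
  χt γ v φ x y = if does (matchAll? γ v φ x y) then 1# else 0#

  IM : RelOp (c ⊔ ℓ)
  IM {n} {k} γ u v =
    label γ u ≡ label γ v ×
    (2 ℕ.< k → ∀ (i₁ i₂ : Fin k) → i₁ ≢ i₂ →
       ∃[ S ] ∃[ T ] (IsInverse {n} S T ×
         (∀ σ → InIm γ σ → ((S · χ γ u i₁ i₂ σ) · T) ≈M χ γ v i₁ i₂ σ)))

  -- IMt^F_k∘γ(u) = IMt^F_k∘γ(v)  (for k ≤ 2 this is just γ(u) = γ(v))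
  -- φ ranges over Im(γ)^{[k]^(2)}; its diagonal values are irrelevant.
  IMt : RelOp (c ⊔ ℓ)
  IMt {n} {k} γ u v =
    label γ u ≡ label γ v ×
    (2 ℕ.< k →
       ∃[ S ] ∃[ T ] (IsInverse {n} S T ×
         (∀ (φ : Fin k → Fin k → Label γ) →
            (∀ i j → i ≢ j → InIm γ (φ i j)) →
            ((S · χt γ u φ) · T) ≈M χt γ v φ)))

{-# OPTIONS --safe #-}

-- IM below IMt: for fixed positions (i, j) the matrix χ_{(i,j),σ} is a sum of
-- matrices χ_φ, so the single conjugating matrix of IMt serves every (i, j).
--
-- IMt below IM: compare arity k with arity k + 2.  Let ρ be stable under IM on
-- V^(k+2).  Similar matrices vanish together, so ρ has the back-and-forth
-- property for replacing two entries at once.  Equality of vertices is not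
-- visible to ρ, but being twins (having the same rows and columns in Γ) is, and ρ
-- does not change when entries are replaced by twins.  Hence copying entries
-- of a tuple to two other positions is compatible with ρ.  Consequently the
-- ρ-label of (u, x, y) determines those of all (u⟨i,(x,y)⟩, ∗, ∗), and the
-- matrix conjugating the χ_σ for the two additional positions conjugates all
-- the χ_φ of the k-ary partition.

module Submission where

open import Defs

open import Data.Bool using (Bool; true; false; if_then_else_)
open import Data.Bool.Properties using (if-cong)
open import Data.Empty using (⊥-elim)
open import Data.Fin as Fin using (Fin; zero; suc; punchIn; punchOut)
open import Data.Fin.Properties using (any?; punchInᵢ≢i; punchIn-injective; punchIn-punchOut)
open import Data.List using ([]; _∷_; _++_; tabulate)
open import Data.List.Relation.Unary.Any using (Any; here; there)
open import Data.List.Relation.Unary.Any.Properties using (++⁺ˡ; ++⁺ʳ; tabulate⁺)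
open import Data.Maybe using (Maybe; just; nothing)
open import Data.Maybe.Properties using (just-injective)
open import Data.Nat as ℕ using (ℕ; z≤n; s≤s)
open import Data.Product using (∃-syntax; _×_; _,_; proj₁; proj₂)
open import Data.Sum using (_⊎_; inj₁; inj₂)
open import Data.Vec as Vec using (lookup)
open import Data.Vec.Properties using (lookup∘tabulate; tabulate-cong)
open import Function using (_∘_; id)
open import Function.Bundles using (Equivalence; mk⇔)
open import Relation.Binary.Core using (Rel)
open import Relation.Binary.Definitions using (Decidable)
open import Relation.Binary.Structures using (IsEquivalence)
open import Relation.Binary.PropositionalEquality using (_≡_; _≢_; refl; sym; trans; cong; cong₂; subst; subst₂)
open import Relation.Nullary using (Dec; yes; no; does)
open import Relation.Nullary.Decidable using (dec-true; dec-false; does-⇔)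

import Algebra.Properties.Semiring.Sum as Sum
import Relation.Binary.Reasoning.Setoid as SetoidReasoning

private
  variable
    n k : ℕ

-- Tuples with two entries replaced

module _ (v : Tuple n k) (i j : Fin k) (x y : Fin n) where

  subst2-fst : subst2 v i j x y i ≡ x
  subst2-fst = if-cong (dec-true (i Fin.≟ i) refl)

  subst2-snd : i ≢ j → subst2 v i j x y j ≡ y
  subst2-snd i≢j = trans (if-cong (dec-false (j Fin.≟ i) (i≢j ∘ sym)))
                         (if-cong (dec-true (j Fin.≟ j) refl))

  subst2-other : ∀ {p} → p ≢ i → p ≢ j → subst2 v i j x y p ≡ v p
  subst2-other {p} p≢i p≢j = trans (if-cong (dec-false (p Fin.≟ i) p≢i))
                                   (if-cong (dec-false (p Fin.≟ j) p≢j))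

  -- `Q` depends on the position, so that the modified tuple can be compared with another tuple
  -- entry by entry.
  subst2-lift : ∀ {ℓ} (Q : Fin k → Fin n → Set ℓ) → i ≢ j → Q i x → Q j y →
                (∀ p → p ≢ i → p ≢ j → Q p (v p)) → ∀ p → Q p (subst2 v i j x y p)
  subst2-lift Q i≢j qi qj q p with p Fin.≟ i
  ... | yes refl = qi
  ... | no p≢i with p Fin.≟ j
  ... | yes refl = qj
  ... | no p≢j = q p p≢i p≢j

if-dec-cong : ∀ {a p q} {A : Set a} {P : Set p} {Q : Set q} {x y : A} →
              (P → Q) → (Q → P) → (P? : Dec P) (Q? : Dec Q) →
              (if does P? then x else y) ≡ (if does Q? then x else y)
if-dec-cong f g P? Q? = if-cong (does-⇔ (mk⇔ f g) P? Q?)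

-- The initial partition `α` and twin vertices

module _ (Γ : Graph n) where

  private
    edge : Fin n → Fin n → Label Γ
    edge x y = label Γ (pair x y)

    entry : Tuple n k → Fin k → Fin k → Maybe (Label Γ)
    entry v i j = if does (i Fin.≟ j) then nothing else just (edge (v i) (v j))

  α-edge : (u v : Tuple n k) → label (α k Γ) u ≡ label (α k Γ) v →
           ∀ {i j} → i ≢ j → edge (u i) (u j) ≡ edge (v i) (v j)
  α-edge {k} u v eq {i} {j} i≢j =
    just-injective (trans (sym (off u)) (trans (trans (sym (look u)) (trans
      (cong (λ M → lookup (lookup M i) j) eq) (look v))) (off v)))
    where
    off : ∀ w → entry w i j ≡ just (edge (w i) (w j))
    off w = if-cong (dec-false (i Fin.≟ j) i≢j)
    look : ∀ w → lookup (lookup (label (α k Γ) w) i) j ≡ entry w i j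
    look w = trans (cong (λ r → lookup r j) (lookup∘tabulate (λ i → Vec.tabulate (entry w i)) i))
                   (lookup∘tabulate (entry w i) j)

  α-cong : (u v : Tuple n k) →
           (∀ {i j} → i ≢ j → edge (u i) (u j) ≡ edge (v i) (v j)) →
           label (α k Γ) u ≡ label (α k Γ) v
  α-cong {k} u v eq = tabulate-cong λ i → tabulate-cong λ j → go i j
    where
    go : ∀ i j → entry u i j ≡ entry v i j
    go i j with i Fin.≟ j
    ... | yes _  = refl
    ... | no i≢j = cong just (eq i≢j)

  -- Here `c` may also be `a` or `b`, so the two ends of an edge can be replaced by twins one after
  -- the other, whatever the opposite end is.
  Twin : Fin n → Fin n → Set
  Twin a b = ∀ c → edge a c ≡ edge b c × edge c a ≡ edge c b

  Twin-reflexive : ∀ {a b} → a ≡ b → Twin a b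
  Twin-reflexive refl c = refl , refl

  TwinInvariant : LPart n k → Set
  TwinInvariant γ = ∀ {u v} → (∀ p → Twin (u p) (v p)) → label γ u ≡ label γ v

  α-twinInvariant : TwinInvariant (α k Γ)
  α-twinInvariant {u = u} {v} tw = α-cong u v λ {i} {j} _ → trans (proj₁ (tw i _)) (proj₂ (tw j _))

-- Invariants of stabilisation

module _ {a} (R : RelOp a) where
  open Schemes R

  -- Induction along the refinement steps: none of them separates related tuples. `pres` is asked of
  -- every `γ`, since the intermediate partitions are arbitrary choices of labels.
  stabilised-below : ∀ {n k ℓ} {γ Z : LPart n k} (_~_ : Rel (Tuple n k) ℓ) →
    (∀ γ → (∀ {u v} → u ~ v → label γ u ≡ label γ v) → ∀ {u v} → u ~ v → R γ u v) →
    Stabilised γ Z →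
    (∀ {u v} → u ~ v → label γ u ≡ label γ v) → ∀ {u v} → u ~ v → label Z u ≡ label Z v
  stabilised-below _~_ pres (done _) below = below
  stabilised-below _~_ pres (step {γ} _ ref st) below =
    stabilised-below _~_ pres st (λ u~v → Equivalence.from (ref _ _) (pres γ below u~v))

  stabilised-refines : (∀ {n k} {γ : LPart n k} {u v} → R γ u v → label γ u ≡ label γ v) →
    ∀ {n k} {γ Z : LPart n k} → Stabilised γ Z → γ ⪯ Z
  stabilised-refines _ (done _) u v eq = eq
  stabilised-refines R⇒≡ (step _ ref st) u v eq =
    R⇒≡ (Equivalence.to (ref u v) (stabilised-refines R⇒≡ st u v eq))

  stabilised-stable : ∀ {n k} {γ Z : LPart n k} → Stabilised γ Z → Stable Z
  stabilised-stable (done s) = s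
  stabilised-stable (step _ _ st) = stabilised-stable st

module _ {c ℓ} (F : Field c ℓ) where
  open WithField F
  open Field F hiding (refl; sym; trans; zero; inverse; isEquivalence)
  private module ≈ = Field F
  open Sum semiring using (sum; sum-cong-≋; ∑-distrib-+; ∑-comm; *-distribˡ-sum; *-distribʳ-sum; sum-replicate-zero)
  open SetoidReasoning setoid

  -- Finite sums

  sumF≡sum : (f : Fin n → Carrier) → sumF f ≡ sum f
  sumF≡sum {ℕ.zero}  f = refl
  sumF≡sum {ℕ.suc n} f = cong (f zero +_) (sumF≡sum (f ∘ suc))

  sumF≈sum : (f : Fin n → Carrier) → sumF f ≈ sum f
  sumF≈sum f = ≈.reflexive (sumF≡sum f)

  sumF-cong : {f g : Fin n → Carrier} → (∀ i → f i ≈ g i) → sumF f ≈ sumF g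
  sumF-cong {f = f} {g} eq = begin
    sumF f ≈⟨ sumF≈sum f ⟩
    sum f  ≈⟨ sum-cong-≋ eq ⟩
    sum g  ≈⟨ sumF≈sum g ⟨
    sumF g ∎

  sumF-zero : {f : Fin n → Carrier} → (∀ i → f i ≈ 0#) → sumF f ≈ 0#
  sumF-zero {n} {f} eq = begin
    sumF f               ≈⟨ sumF≈sum f ⟩
    sum f                ≈⟨ sum-cong-≋ eq ⟩
    sum {n} (λ _ → 0#)   ≈⟨ sum-replicate-zero n ⟩
    0#                   ∎

  sumF-+ : (f g : Fin n → Carrier) → sumF (λ i → f i + g i) ≈ sumF f + sumF g
  sumF-+ f g = begin
    sumF (λ i → f i + g i) ≈⟨ sumF≈sum (λ i → f i + g i) ⟩
    sum (λ i → f i + g i)  ≈⟨ ∑-distrib-+ f g ⟩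
    sum f + sum g          ≈⟨ +-cong (sumF≈sum f) (sumF≈sum g) ⟨
    sumF f + sumF g        ∎

  sumF-*ˡ : ∀ x (f : Fin n → Carrier) → x * sumF f ≈ sumF (λ i → x * f i)
  sumF-*ˡ x f = begin
    x * sumF f           ≈⟨ *-congˡ (sumF≈sum f) ⟩
    x * sum f            ≈⟨ *-distribˡ-sum x f ⟩
    sum (λ i → x * f i)  ≈⟨ sumF≈sum (λ i → x * f i) ⟨
    sumF (λ i → x * f i) ∎

  sumF-*ʳ : ∀ x (f : Fin n → Carrier) → sumF f * x ≈ sumF (λ i → f i * x)
  sumF-*ʳ x f = begin
    sumF f * x           ≈⟨ *-congʳ (sumF≈sum f) ⟩
    sum f * x            ≈⟨ *-distribʳ-sum x f ⟩
    sum (λ i → f i * x)  ≈⟨ sumF≈sum (λ i → f i * x) ⟨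
    sumF (λ i → f i * x) ∎

  sumF-swap : ∀ {m} (f : Fin m → Fin n → Carrier) →
              sumF (λ i → sumF (f i)) ≈ sumF (λ j → sumF (λ i → f i j))
  sumF-swap f = begin
    sumF (λ i → sumF (f i))           ≈⟨ sumF-cong (λ i → sumF≈sum (f i)) ⟩
    sumF (λ i → sum (f i))            ≈⟨ sumF≈sum (λ i → sum (f i)) ⟩
    sum (λ i → sum (f i))             ≈⟨ ∑-comm f ⟩
    sum (λ j → sum (λ i → f i j))     ≈⟨ sumF≈sum (λ j → sum (λ i → f i j)) ⟨
    sumF (λ j → sum (λ i → f i j))    ≈⟨ sumF-cong (λ j → sumF≈sum (λ i → f i j)) ⟨
    sumF (λ j → sumF (λ i → f i j))   ∎

  -- Matrix algebra and similarity

  ≈M-sym : {A B : Mat n} → A ≈M B → B ≈M A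
  ≈M-sym A≈B x y = ≈.sym (A≈B x y)

  ≈M-trans : {A B C : Mat n} → A ≈M B → B ≈M C → A ≈M C
  ≈M-trans A≈B B≈C x y = ≈.trans (A≈B x y) (B≈C x y)

  ·-congˡ : {A B C : Mat n} → B ≈M C → (A · B) ≈M (A · C)
  ·-congˡ B≈C x y = sumF-cong (λ z → *-congˡ (B≈C z y))

  ·-congʳ : {A B C : Mat n} → B ≈M C → (B · A) ≈M (C · A)
  ·-congʳ B≈C x y = sumF-cong (λ z → *-congʳ (B≈C x z))

  ·-assoc : (A B C : Mat n) → ((A · B) · C) ≈M (A · (B · C))
  ·-assoc {n} A B C x y = begin
    sumF (λ z → sumF (λ w → A x w * B w z) * C z y)   ≈⟨ sumF-cong {n} (λ z → sumF-*ʳ {n} _ _) ⟩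
    sumF (λ z → sumF (λ w → A x w * B w z * C z y))   ≈⟨ sumF-swap (λ z w → A x w * B w z * C z y) ⟩
    sumF (λ w → sumF (λ z → A x w * B w z * C z y))   ≈⟨ sumF-cong {n} (λ w → sumF-cong {n} (λ z → *-assoc _ _ _)) ⟩
    sumF (λ w → sumF (λ z → A x w * (B w z * C z y))) ≈⟨ sumF-cong {n} (λ w → sumF-*ˡ {n} _ _) ⟨
    sumF (λ w → A x w * sumF (λ z → B w z * C z y))   ∎

  ·-identityˡ : (A : Mat n) → (I · A) ≈M A
  ·-identityˡ A x y = go x (λ z → A z y)
    where
    go : ∀ {m} (x : Fin m) (f : Fin m → Carrier) → sumF (λ z → I x z * f z) ≈ f x
    go {ℕ.suc m} zero f = ≈.trans (+-cong (*-identityˡ _) (sumF-zero {m} (λ i → zeroˡ _))) (+-identityʳ _)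
    go (suc x) f = ≈.trans (+-cong (zeroˡ _) (go x (f ∘ suc))) (+-identityˡ _)

  ·-identityʳ : (A : Mat n) → (A · I) ≈M A
  ·-identityʳ A x y = go y (A x)
    where
    go : ∀ {m} (y : Fin m) (f : Fin m → Carrier) → sumF (λ z → f z * I z y) ≈ f y
    go {ℕ.suc m} zero f = ≈.trans (+-cong (*-identityʳ _) (sumF-zero {m} (λ i → zeroʳ _))) (+-identityʳ _)
    go (suc y) f = ≈.trans (+-cong (zeroʳ _) (go y (f ∘ suc))) (+-identityˡ _)

  module _ {S T : Mat n} (inv : IsInverse S T) {M M′ : Mat n} where

    -- Without `T`, each entry of the equation pairs a row of `S` with a column of `M`, and a row of
    -- `M′` with a column of `S`. This is the shape that `aggregate` treats.
    conjugate⇒intertwine : ((S · M) · T) ≈M M′ → (S · M) ≈M (M′ · S)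
    conjugate⇒intertwine eq =
      ≈M-trans (≈M-sym (·-identityʳ (S · M)))
      (≈M-trans (·-congˡ (≈M-sym (proj₂ inv)))
      (≈M-trans (≈M-sym (·-assoc (S · M) T S))
      (·-congʳ eq)))

    intertwine⇒conjugate : (S · M) ≈M (M′ · S) → ((S · M) · T) ≈M M′
    intertwine⇒conjugate eq =
      ≈M-trans (·-congʳ eq)
      (≈M-trans (·-assoc M′ S T)
      (≈M-trans (·-congˡ (proj₁ inv))
      (·-identityʳ M′)))

    -- `M` equals `T · (S · M)`, hence `T · (M′ · S)`.
    conjugate-zero : ((S · M) · T) ≈M M′ → (∀ x y → M′ x y ≈ 0#) → ∀ x y → M x y ≈ 0#
    conjugate-zero eq M′≈0 x y = begin
      M x y             ≈⟨ ·-identityˡ M x y ⟨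
      (I · M) x y       ≈⟨ ·-congʳ {A = M} (proj₂ inv) x y ⟨
      ((T · S) · M) x y ≈⟨ ·-assoc T S M x y ⟩
      (T · (S · M)) x y ≈⟨ sumF-zero (λ z → ≈.trans (*-congˡ (≈.trans
                             (conjugate⇒intertwine eq z y)
                             (sumF-zero (λ w → ≈.trans (*-congʳ (M′≈0 z w)) (zeroˡ _)))))
                             (zeroʳ _)) ⟩
      0#                ∎

  -- From indicators of classes to functions constant on classes

  module Aggregation {a r} {A : Set a} {_~_ : Rel A r}
                     (isEquivalence : IsEquivalence _~_) (_~?_ : Decidable _~_) where
    private module ~ = IsEquivalence isEquivalence

    indicator : A → A → Carrier
    indicator b a = if does (b ~? a) then 1# else 0#

    Respects : (A → Carrier) → Set _
    Respects p = ∀ {a b} → a ~ b → p a ≈ p b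

    private
      module _ (p : A → Carrier) (resp : Respects p) (a : A) where

        erase : A → Carrier
        erase b = if does (b ~? a) then 0# else p b

        erase-resp : Respects erase
        erase-resp {b} {b′} b~b′ with b ~? a | b′ ~? a
        ... | yes _   | yes _    = ≈.refl
        ... | yes b~a | no b′≁a  = ⊥-elim (b′≁a (~.trans (~.sym b~b′) b~a))
        ... | no b≁a  | yes b′~a = ⊥-elim (b≁a (~.trans b~b′ b′~a))
        ... | no _    | no _     = resp b~b′

        -- On the class of `a` the function `p` has the constant value `p a`; this peels off one
        -- multiple of an indicator.
        erase-split : ∀ b → p b ≈ erase b + indicator b a * p a
        erase-split b with b ~? a
        ... | yes b~a = ≈.sym (≈.trans (+-identityˡ _) (≈.trans (*-identityˡ _) (≈.sym (resp b~a))))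
        ... | no _    = ≈.sym (≈.trans (+-congˡ (zeroˡ _)) (+-identityʳ _))

        -- Elements of the class of `a` leave the list but now have value zero, which is why the
        -- support condition is a disjunction.
        erase-support : ∀ {as b} → p b ≈ 0# ⊎ Any (b ~_) (a ∷ as) → erase b ≈ 0# ⊎ Any (b ~_) as
        erase-support {b = b} s with b ~? a | s
        ... | yes _   | _                = inj₁ ≈.refl
        ... | no _    | inj₁ z           = inj₁ z
        ... | no b≁a  | inj₂ (here b~a)  = ⊥-elim (b≁a b~a)
        ... | no _    | inj₂ (there any) = inj₂ any

    module _ {m n} {s : Fin m → Carrier} {f : Fin m → A} {t : Fin n → Carrier} {g : Fin n → A}
             (eq : ∀ a → sumF (λ z → s z * indicator (f z) a) ≈ sumF (λ z → indicator (g z) a * t z))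
             where

      private
        -- Induction on a list of classes supporting p.
        aggregate-supported : ∀ as (p : A → Carrier) → Respects p →
          (∀ z → p (f z) ≈ 0# ⊎ Any (f z ~_) as) →
          (∀ z → p (g z) ≈ 0# ⊎ Any (g z ~_) as) →
          sumF (λ z → s z * p (f z)) ≈ sumF (λ z → p (g z) * t z)
        aggregate-supported [] p resp sf sg = ≈.trans
          (sumF-zero (λ z → ≈.trans (*-congˡ (none (sf z))) (zeroʳ _)))
          (≈.sym (sumF-zero (λ z → ≈.trans (*-congʳ (none (sg z))) (zeroˡ _))))
          where
          none : ∀ {b} → p b ≈ 0# ⊎ Any (b ~_) [] → p b ≈ 0#
          none (inj₁ z) = z
        aggregate-supported (a ∷ as) p resp sf sg = begin
          sumF (λ z → s z * p (f z))
            ≈⟨ sumF-cong (λ z → ≈.trans (*-congˡ (split (f z)))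
                 (≈.trans (distribˡ _ _ _) (+-congˡ (≈.sym (*-assoc _ _ _))))) ⟩
          sumF (λ z → s z * p′ (f z) + s z * indicator (f z) a * p a)
            ≈⟨ sumF-+ {m} _ _ ⟩
          sumF (λ z → s z * p′ (f z)) + sumF (λ z → s z * indicator (f z) a * p a)
            ≈⟨ +-congˡ (sumF-*ʳ {m} _ _) ⟨
          sumF (λ z → s z * p′ (f z)) + sumF (λ z → s z * indicator (f z) a) * p a
            ≈⟨ +-cong ih (*-congʳ (eq a)) ⟩
          sumF (λ z → p′ (g z) * t z) + sumF (λ z → indicator (g z) a * t z) * p a
            ≈⟨ +-congˡ (sumF-*ʳ {n} _ _) ⟩
          sumF (λ z → p′ (g z) * t z) + sumF (λ z → indicator (g z) a * t z * p a)
            ≈⟨ sumF-+ {n} _ _ ⟨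
          sumF (λ z → p′ (g z) * t z + indicator (g z) a * t z * p a)
            -- Commutativity of the field moves `p a` past `t z`, to the end where it can be taken
            -- out of the sum.
            ≈⟨ sumF-cong (λ z → ≈.trans (*-congʳ (split (g z)))
                 (≈.trans (distribʳ _ _ _) (+-congˡ (≈.trans (*-assoc _ _ _)
                 (≈.trans (*-congˡ (*-comm _ _)) (≈.sym (*-assoc _ _ _))))))) ⟨
          sumF (λ z → p (g z) * t z) ∎
          where
          p′ = erase p resp a
          split = erase-split p resp a
          ih = aggregate-supported as p′ (erase-resp p resp a)
                 (λ z → erase-support p resp a (sf z)) (λ z → erase-support p resp a (sg z))

      -- Only the values of `f` and `g` enter the sums, so listing them covers all classes that
      -- matter. A repeated class is harmless: once erased, it contributes zero.
      aggregate : ∀ p → Respects p → sumF (λ z → s z * p (f z)) ≈ sumF (λ z → p (g z) * t z)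
      aggregate p resp = aggregate-supported (tabulate f ++ tabulate g) p resp
        (λ z → inj₂ (++⁺ˡ (tabulate⁺ z ~.refl)))
        (λ z → inj₂ (++⁺ʳ (tabulate f) (tabulate⁺ z ~.refl)))

  -- Cells (true, x, y) and (false, x, y) are the entries of the left and of
  -- the right matrix of a similarity.
  Cell : ℕ → Set
  Cell n = Bool × Fin n × Fin n

  module _ {r} {_~_ : Rel (Cell n) r} (isEquivalence : IsEquivalence _~_) (_~?_ : Decidable _~_)
           {S T : Mat n} (inv : IsInverse S T) where
    open Aggregation isEquivalence _~?_

    -- Conjugation is linear, and both matrices are the same linear combination of class indicators,
    -- because a class may contain cells of both sides.
    conjugate-aggregate :
      (∀ a → ((S · (λ x y → indicator (true , x , y) a)) · T) ≈M (λ x y → indicator (false , x , y) a)) →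
      ∀ p → Respects p → ((S · (λ x y → p (true , x , y))) · T) ≈M (λ x y → p (false , x , y))
    conjugate-aggregate eq p resp = intertwine⇒conjugate inv λ x y →
      aggregate {s = S x} {f = λ z → true , z , y} {t = λ z → S z y} {g = λ z → false , x , z}
        (λ a → conjugate⇒intertwine inv (eq a) x y) p resp

  open Schemes

  -- IM below IMt

  -- `γ` stands for any stage of the `IM` iteration that is still coarser than `ρ`, as
  -- `stabilised-below` requires.
  IMt-refines-IM : (ρ : LPart n k) → Stable IMt ρ → (γ : LPart n k) →
    (∀ {u v} → label ρ u ≡ label ρ v → label γ u ≡ label γ v) →
    ∀ {u v} → label ρ u ≡ label ρ v → IM γ u v
  IMt-refines-IM {n} {k} ρ stable γ γ⪯ρ {u} {v} ρu≡ρv = γ⪯ρ ρu≡ρv , sim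
    where
    side : Bool → Tuple n k
    side b = if b then u else v

    lab : Cell n → Fin k → Fin k → Label ρ
    lab (b , x , y) i j = label ρ (subst2 (side b) i j x y)

    _~_ : Rel (Cell n) _
    a ~ b = ∀ i j → i ≢ j → lab a i j ≡ lab b i j

    ~-isEquivalence : IsEquivalence _~_
    ~-isEquivalence = record
      { refl  = λ _ _ _ → refl
      ; sym   = λ e i j ne → sym (e i j ne)
      ; trans = λ e f i j ne → trans (e i j ne) (f i j ne)
      }

    -- Deciding by `matchAll?` makes the indicator of the class of `a` definitionally the matrix
    -- `χt` for `φ = lab a`.
    _~?_ : Decidable _~_
    (b , x , y) ~? a = matchAll? ρ (side b) (lab a) x y

    sim : 2 ℕ.< k → ∀ i j → i ≢ j → ∃[ S ] ∃[ T ] (IsInverse {n} S T ×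
            (∀ σ → InIm γ σ → ((S · χ γ u i j σ) · T) ≈M χ γ v i j σ))
    sim 2<k i j i≢j with proj₂ (Equivalence.to (stable u v) ρu≡ρv) 2<k
    ... | S , T , inv , conj = S , T , inv , λ σ _ →
      conjugate-aggregate ~-isEquivalence _~?_ inv
        (λ (b , x , y) → conj (lab (b , x , y)) (λ i j _ → subst2 (side b) i j x y , refl))
        (λ (b , x , y) → χ γ (side b) i j σ x y)
        -- Cells of one class agree in `ρ` at the positions `i`, `j` in particular, hence in `γ`.
        (λ a~b → ≈.reflexive (cong (λ l → if does (_≟L_ γ l σ) then 1# else 0#) (γ⪯ρ (a~b i j i≢j))))

  -- IMt below IM

  conjugate-identity : {A B : Mat n} → A ≈M B → ((I · A) · I) ≈M B
  conjugate-identity {A = A} A≈B =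
    ≈M-trans (·-identityʳ (I · A)) (≈M-trans (·-identityˡ A) A≈B)

  -- Putting the same two vertices into entrywise twin tuples leaves them entrywise twin, so the
  -- matrices coincide and the identity conjugates them.
  IM-twin : (Γ : Graph n) (γ : LPart n k) → TwinInvariant Γ γ →
            ∀ {u v} → (∀ p → Twin Γ (u p) (v p)) → IM γ u v
  IM-twin {n} {k} Γ γ tinv {u} {v} tw = tinv tw , λ _ i j i≢j → I , I ,
    (·-identityˡ I , ·-identityˡ I) , λ σ _ → conjugate-identity λ x y →
      ≈.reflexive (cong (λ l → if does (_≟L_ γ l σ) then 1# else 0#) (tinv (tw′ i j x y)))
    where
    tw′ : ∀ i j x y p → Twin Γ (subst2 u i j x y p) (subst2 v i j x y p)
    tw′ i j x y p with does (p Fin.≟ i)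
    ... | true = Twin-reflexive Γ refl
    ... | false with does (p Fin.≟ j)
    ... | true = Twin-reflexive Γ refl
    ... | false = tw p

  -- Back-and-forth, detection of twins and copying of entries

  module _ (ρ : LPart n k) (stable : Stable IM ρ) (2<k : 2 ℕ.< k) where

    -- If no answer existed, the matrix of `w′` for the label reached from `w` would be zero, and by
    -- similarity that of `w` too; but the latter has a one at `(a , b)`.
    back-and-forth : ∀ {w w′} → label ρ w ≡ label ρ w′ → ∀ {i j} → i ≢ j → ∀ a b →
      ∃[ a′ ] ∃[ b′ ] (label ρ (subst2 w i j a b) ≡ label ρ (subst2 w′ i j a′ b′))
    back-and-forth {w} {w′} eq {i} {j} i≢j a b
      -- The search is finite, so the argument by contradiction is constructive.
      with any? (λ a′ → any? (λ b′ → _≟L_ ρ (label ρ (subst2 w i j a b)) (label ρ (subst2 w′ i j a′ b′))))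
         | proj₂ (Equivalence.to (stable w w′) eq) 2<k i j i≢j
    ... | yes found | _ = found
    ... | no none | S , T , inv , conj = ⊥-elim (0≉1 (≈.trans (≈.sym zero-entry) one-entry))
      where
      σ = label ρ (subst2 w i j a b)
      one-entry : χ ρ w i j σ a b ≈ 1#
      one-entry = ≈.reflexive (if-cong (dec-true (_≟L_ ρ σ σ) refl))
      zero-entry : χ ρ w i j σ a b ≈ 0#
      zero-entry = conjugate-zero inv (conj σ (_ , refl))
        (λ x y → ≈.reflexive (if-cong (dec-false (_≟L_ ρ _ σ) (λ e → none (x , y , sym e))))) a b

  -- A move replaces two entries, so testing `p` against `q` takes two further positions; hence
  -- arity at least four.
  two-others : (p q : Fin (4 ℕ.+ k)) → p ≢ q →
    ∃[ r ] ∃[ s ] (r ≢ s × p ≢ r × q ≢ r × p ≢ s × q ≢ s)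
  two-others p q p≢q = other zero , other (suc zero) ,
    (λ e → 0≢1 (punchIn-injective _ _ _ (punchIn-injective p _ _ e))) ,
    p≢ zero , q≢ zero , p≢ (suc zero) , q≢ (suc zero)
    where
    0≢1 : ∀ {k} → zero {ℕ.suc k} ≢ suc zero
    0≢1 ()
    other : Fin (2 ℕ.+ _) → Fin (4 ℕ.+ _)
    other z = punchIn p (punchIn (punchOut p≢q) z)
    p≢ : ∀ z → p ≢ other z
    p≢ z e = punchInᵢ≢i p _ (sym e)
    q≢ : ∀ z → q ≢ other z
    q≢ z e = punchInᵢ≢i (punchOut p≢q) z
      (punchIn-injective p _ _ (trans (sym e) (sym (punchIn-punchOut p≢q))))

  module _ (Γ : Graph n) (ρ : LPart n (4 ℕ.+ k)) (stable : Stable IM ρ)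
           (α⪯ρ : α (4 ℕ.+ k) Γ ⪯ ρ) (tinv : TwinInvariant Γ ρ) where

    private
      respond : ∀ {w w′} → label ρ w ≡ label ρ w′ → ∀ {i j} → i ≢ j → ∀ a b →
        ∃[ a′ ] ∃[ b′ ] (label ρ (subst2 w i j a b) ≡ label ρ (subst2 w′ i j a′ b′))
      respond = back-and-forth ρ stable (s≤s (s≤s (s≤s z≤n)))

    -- A test vertex `c` put into `w′` is answered by some `a` in `w`. The edges between `a` and the
    -- equal entries `w p`, `w q` agree, and `ρ` carries this back to `c`.
    detect-twin : ∀ {w w′} → label ρ w ≡ label ρ w′ → ∀ {p q} → p ≢ q →
                  w p ≡ w q → Twin Γ (w′ p) (w′ q)
    detect-twin {w} {w′} eq {p} {q} p≢q wp≡wq c with two-others p q p≢q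
    ... | r , s , r≢s , p≢r , q≢r , p≢s , q≢s with respond (sym eq) r≢s c c
    ... | a , b , eq′ = row , col
      where
      E : Fin n → Fin n → Label Γ
      E x y = label Γ (pair x y)

      same = α-edge Γ (subst2 w′ r s c c) (subst2 w r s a b) (α⪯ρ _ _ eq′)

      row-of : ∀ t → t ≢ r → t ≢ s → E (w′ t) c ≡ E (w t) a
      row-of t t≢r t≢s = subst₂ _≡_
        (cong₂ E (subst2-other w′ r s c c t≢r t≢s) (subst2-fst w′ r s c c))
        (cong₂ E (subst2-other w r s a b t≢r t≢s) (subst2-fst w r s a b)) (same t≢r)

      col-of : ∀ t → t ≢ r → t ≢ s → E c (w′ t) ≡ E a (w t)
      col-of t t≢r t≢s = subst₂ _≡_
        (cong₂ E (subst2-fst w′ r s c c) (subst2-other w′ r s c c t≢r t≢s))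
        (cong₂ E (subst2-fst w r s a b) (subst2-other w r s a b t≢r t≢s)) (same (t≢r ∘ sym))

      row = trans (row-of p p≢r p≢s) (trans (cong (λ x → E x a) wp≡wq) (sym (row-of q q≢r q≢s)))
      col = trans (col-of p p≢r p≢s) (trans (cong (E a) wp≡wq) (sym (col-of q q≢r q≢s)))

    -- The answers `a`, `b` to the copied entries are twins of `w′ q` and `w′ q′` by `detect-twin`,
    -- and `ρ` does not notice exchanging twins.
    copy : ∀ {w w′} → label ρ w ≡ label ρ w′ → ∀ {p p′ q q′} → p ≢ p′ →
      q ≢ p → q ≢ p′ → q′ ≢ p → q′ ≢ p′ →
      label ρ (subst2 w p p′ (w q) (w q′)) ≡ label ρ (subst2 w′ p p′ (w′ q) (w′ q′))
    copy {w} {w′} eq {p} {p′} {q} {q′} p≢p′ q≢p q≢p′ q′≢p q′≢p′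
      with respond eq p≢p′ (w q) (w q′)
    ... | a , b , eq′ = trans eq′ (tinv twins)
      where
      left   = subst2-other w p p′ (w q) (w q′)
      right  = subst2-other w′ p p′ a b
      target = subst2 w′ p p′ (w′ q) (w′ q′)
      twin-fst : Twin Γ a (w′ q)
      twin-fst = subst₂ (Twin Γ) (subst2-fst w′ p p′ a b) (right q≢p q≢p′)
        (detect-twin eq′ (q≢p ∘ sym)
          (trans (subst2-fst w p p′ (w q) (w q′)) (sym (left q≢p q≢p′))))
      twin-snd : Twin Γ b (w′ q′)
      twin-snd = subst₂ (Twin Γ) (subst2-snd w′ p p′ a b p≢p′) (right q′≢p q′≢p′)
        (detect-twin eq′ (q′≢p′ ∘ sym)
          (trans (subst2-snd w p p′ (w q) (w q′) p≢p′) (sym (left q′≢p q′≢p′))))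
      twins : ∀ t → Twin Γ (subst2 w′ p p′ a b t) (target t)
      twins = subst2-lift w′ p p′ a b (λ t z → Twin Γ z (target t)) p≢p′
        (subst (Twin Γ a) (sym (subst2-fst w′ p p′ (w′ q) (w′ q′))) twin-fst)
        (subst (Twin Γ b) (sym (subst2-snd w′ p p′ (w′ q) (w′ q′) p≢p′)) twin-snd)
        (λ t t≢p t≢p′ → Twin-reflexive Γ (sym (subst2-other w′ p p′ (w′ q) (w′ q′) t≢p t≢p′)))

    -- Comparison of arities `2 + k` and `4 + k`

    -- The two additional positions are put at 1 and 2, because position 0
    -- plays a special role in pr₂.
    embed : Fin (2 ℕ.+ k) → Fin (4 ℕ.+ k)
    embed zero    = zero
    embed (suc i) = suc (suc (suc i))

    embed-injective : ∀ {i j} → embed i ≡ embed j → i ≡ j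
    embed-injective {zero}  {zero}  _    = refl
    embed-injective {suc i} {suc j} refl = refl

    extend : Tuple n (2 ℕ.+ k) → Fin n → Fin n → Tuple n (4 ℕ.+ k)
    extend u x y zero                = u zero
    extend u x y (suc zero)          = x
    extend u x y (suc (suc zero))    = y
    extend u x y (suc (suc (suc i))) = u (suc i)

    extend-embed : ∀ u x y i → extend u x y (embed i) ≡ u i
    extend-embed u x y zero    = refl
    extend-embed u x y (suc i) = refl

    -- The filler is the entry at index 1 because `pr₂tuple` repeats its second vertex at every
    -- position but 0; thus padding commutes with `pr₂tuple`.
    pad : Tuple n (2 ℕ.+ k) → Tuple n (4 ℕ.+ k)
    pad u = extend u (u (suc zero)) (u (suc zero))

    -- Tuples are functions, and a labelling might separate pointwise equal ones; twin invariance
    -- excludes this.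
    ρ-ext : ∀ {u v} → (∀ p → u p ≡ v p) → label ρ u ≡ label ρ v
    ρ-ext eq = tinv (λ p → Twin-reflexive Γ (eq p))

    extra₁ extra₂ : Fin (4 ℕ.+ k)
    extra₁ = suc zero
    extra₂ = suc (suc zero)

    extra₁≢extra₂ : extra₁ ≢ extra₂
    extra₁≢extra₂ ()

    extra₁≢embed : ∀ i → extra₁ ≢ embed i
    extra₁≢embed zero    ()
    extra₁≢embed (suc i) ()

    extra₂≢embed : ∀ i → extra₂ ≢ embed i
    extra₂≢embed zero    ()
    extra₂≢embed (suc i) ()

    -- Two uses of `copy`: first the extra entries `x`, `y` go to the positions of `i` and `j`, then
    -- the extra positions are reset to the filler of `pad`.
    extend-determines : ∀ u v {x y x′ y′} →
      label ρ (extend u x y) ≡ label ρ (extend v x′ y′) →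
      ∀ {i j} → i ≢ j → label ρ (pad (subst2 u i j x y)) ≡ label ρ (pad (subst2 v i j x′ y′))
    extend-determines u v {x} {y} {x′} {y′} eq {i} {j} i≢j =
      trans (sym (ρ-ext (padded _ _ _))) (trans eq₂ (ρ-ext (padded _ _ _)))
      where
      moved : ∀ u x y t → subst2 (extend u x y) (embed i) (embed j) x y t ≡ extend (subst2 u i j x y) x y t
      moved u x y = subst2-lift (extend u x y) (embed i) (embed j) x y (λ t z → z ≡ extend (subst2 u i j x y) x y t) (i≢j ∘ embed-injective)
        (sym (trans (extend-embed _ x y i) (subst2-fst u i j x y)))
        (sym (trans (extend-embed _ x y j) (subst2-snd u i j x y i≢j)))
        other
        where
        other : ∀ t → t ≢ embed i → t ≢ embed j → extend u x y t ≡ extend (subst2 u i j x y) x y t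
        other zero ≢i ≢j = sym (subst2-other u i j x y (≢i ∘ cong embed) (≢j ∘ cong embed))
        other (suc zero) _ _ = refl
        other (suc (suc zero)) _ _ = refl
        other (suc (suc (suc t))) ≢i ≢j = sym (subst2-other u i j x y (≢i ∘ cong embed) (≢j ∘ cong embed))

      eq₁ : label ρ (extend (subst2 u i j x y) x y) ≡ label ρ (extend (subst2 v i j x′ y′) x′ y′)
      eq₁ = trans (sym (ρ-ext (moved u x y))) (trans
        (copy eq {q = extra₁} {extra₂} (i≢j ∘ embed-injective)
          (extra₁≢embed i) (extra₁≢embed j) (extra₂≢embed i) (extra₂≢embed j))
        (ρ-ext (moved v x′ y′)))

      -- The source is the position of index 1 of the short tuple, read after the substitution at
      -- `i` and `j`.
      eq₂ = copy eq₁ {extra₁} {extra₂} {embed (suc zero)} {embed (suc zero)} extra₁≢extra₂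
        (λ ()) (λ ()) (λ ()) (λ ())

      padded : ∀ u x y t →
        subst2 (extend u x y) extra₁ extra₂ (u (suc zero)) (u (suc zero)) t ≡ pad u t
      padded u x y zero                = refl
      padded u x y (suc zero)          = refl
      padded u x y (suc (suc zero))    = refl
      padded u x y (suc (suc (suc t))) = refl

    subst2-pad : ∀ u x y → label ρ (subst2 (pad u) extra₁ extra₂ x y) ≡ label ρ (extend u x y)
    subst2-pad u x y = ρ-ext λ where
      zero                → refl
      (suc zero)          → refl
      (suc (suc zero))    → refl
      (suc (suc (suc t))) → refl

    _≋_ : Rel (Tuple n (2 ℕ.+ k)) _
    u ≋ v = label ρ (pad u) ≡ label ρ (pad v)

    α-below-pad : ∀ {u v} → u ≋ v → label (α (2 ℕ.+ k) Γ) u ≡ label (α (2 ℕ.+ k) Γ) v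
    α-below-pad {u} {v} eq = α-cong Γ u v λ {i} {j} i≢j → subst₂ _≡_
      (cong₂ E (pad-embed u i) (pad-embed u j))
      (cong₂ E (pad-embed v i) (pad-embed v j))
      (α-edge Γ (pad u) (pad v) (α⪯ρ _ _ eq) (i≢j ∘ embed-injective))
      where
      E : Fin n → Fin n → Label Γ
      E x y = label Γ (pair x y)
      pad-embed : ∀ u i → pad u (embed i) ≡ u i
      pad-embed u = extend-embed u (u (suc zero)) (u (suc zero))

    pad-refines-IMt : ∀ γ → (∀ {u v} → u ≋ v → label γ u ≡ label γ v) →
                      ∀ {u v} → u ≋ v → IMt γ u v
    pad-refines-IMt γ below {u} {v} u≋v = below u≋v , sim
      where
      side : Bool → Tuple n (2 ℕ.+ k)
      side b = if b then u else v

      tuple : Cell n → Tuple n (4 ℕ.+ k)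
      tuple (b , x , y) = subst2 (pad (side b)) extra₁ extra₂ x y

      _~_ : Rel (Cell n) _
      a ~ b = label ρ (tuple a) ≡ label ρ (tuple b)

      ~-isEquivalence : IsEquivalence _~_
      ~-isEquivalence = record { refl = refl ; sym = sym ; trans = trans }

      _~?_ : Decidable _~_
      a ~? b = _≟L_ ρ (label ρ (tuple a)) (label ρ (tuple b))

      γ-agree : ∀ b b′ {x y x′ y′} → (b , x , y) ~ (b′ , x′ , y′) → ∀ {i j} → i ≢ j →
        label γ (subst2 (side b) i j x y) ≡ label γ (subst2 (side b′) i j x′ y′)
      γ-agree b b′ eq i≢j = below (extend-determines (side b) (side b′)
        (trans (sym (subst2-pad (side b) _ _)) (trans eq (subst2-pad (side b′) _ _))) i≢j)

      sim : 2 ℕ.< 2 ℕ.+ k → ∃[ S ] ∃[ T ] (IsInverse {n} S T ×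
              (∀ φ → (∀ i j → i ≢ j → InIm γ (φ i j)) → ((S · χt γ u φ) · T) ≈M χt γ v φ))
      sim _ with proj₂ (Equivalence.to (stable (pad u) (pad v)) u≋v) (s≤s (s≤s (s≤s z≤n))) extra₁ extra₂ extra₁≢extra₂
      ... | S , T , inv , conj = S , T , inv , λ φ _ →
        conjugate-aggregate ~-isEquivalence _~?_ inv
          -- By the choice of `_~?_`, the class indicator is `χ` of `ρ` at the two extra positions
          -- for the label of `tuple a`.
          (λ a → conj (label ρ (tuple a)) (tuple a , refl))
          (λ (b , x , y) → χt γ (side b) φ x y)
          (λ {a} {a′} → resp φ a a′)
        where
        resp : ∀ φ ((b , x , y) (b′ , x′ , y′) : Cell n) → (b , x , y) ~ (b′ , x′ , y′) →
               χt γ (side b) φ x y ≈ χt γ (side b′) φ x′ y′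
        resp φ (b , x , y) (b′ , x′ , y′) eq = ≈.reflexive (if-dec-cong
          (λ h i j i≢j → trans (sym (γ-agree b b′ eq i≢j)) (h i j i≢j))
          (λ h i j i≢j → trans (γ-agree b b′ eq i≢j) (h i j i≢j))
          (matchAll? γ (side b) φ x y) (matchAll? γ (side b′) φ x′ y′))

    pad-pr₂ : ∀ w → label ρ (pr₂tuple w) ≡ label ρ (pad (pr₂tuple w))
    pad-pr₂ w = ρ-ext λ where
      zero                → refl
      (suc zero)          → refl
      (suc (suc zero))    → refl
      (suc (suc (suc t))) → refl

  -- The two comparisons of schemes

  IM⪯IMt : SchemeLeq IM IMt
  IM⪯IMt k 1≤k = k , 1≤k , go
    where
    go : ∀ n (Γ : Graph n) (P Q : LPart n 2) → Scheme IM k Γ P → Scheme IMt k Γ Q → P ⪯ Q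
    go n Γ _ _ one one = λ _ _ → id
    go n Γ _ _ one (many (s≤s ()) _)
    go n Γ _ _ (many (s≤s ()) _) one
    go n Γ _ _ (many _ stX) (many {Z = ρ} _ stY) a b =
      stabilised-below IM (λ u v → label ρ u ≡ label ρ v)
        (IMt-refines-IM ρ (stabilised-stable IMt stY)) stX
        (stabilised-refines IMt proj₁ stY _ _)

  IMt⪯IM : SchemeLeq IMt IM
  IMt⪯IM (ℕ.suc ℕ.zero) 1≤1 = 1 , 1≤1 , go
    where
    go : ∀ n (Γ : Graph n) (P Q : LPart n 2) → Scheme IMt 1 Γ P → Scheme IM 1 Γ Q → P ⪯ Q
    go n Γ _ _ one one = λ _ _ → id
    go n Γ _ _ _ (many (s≤s ()) _)
    go n Γ _ _ (many (s≤s ()) _) _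
  -- Two extra positions are added to arity `2 + k`, which also gives the four positions that
  -- `detect-twin` needs.
  IMt⪯IM (ℕ.suc (ℕ.suc k)) _ = 4 ℕ.+ k , s≤s z≤n , go
    where
    go : ∀ n (Γ : Graph n) (P Q : LPart n 2) →
         Scheme IMt (2 ℕ.+ k) Γ P → Scheme IM (4 ℕ.+ k) Γ Q → P ⪯ Q
    go n Γ _ _ (many _ stX) (many {Z = ρ} _ stY) a b eq =
      stabilised-below IMt (_≋_ Γ ρ stable α⪯ρ tinv) (pad-refines-IMt Γ ρ stable α⪯ρ tinv) stX
        (α-below-pad Γ ρ stable α⪯ρ tinv)
        (trans (sym (pad-pr₂ Γ ρ stable α⪯ρ tinv a)) (trans eq (pad-pr₂ Γ ρ stable α⪯ρ tinv b)))
      where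
      stable = stabilised-stable IM stY
      α⪯ρ = stabilised-refines IM proj₁ stY
      tinv : TwinInvariant Γ ρ
      -- `α` is twin invariant, and each `IM` step preserves this.
      tinv = stabilised-below IM (λ u v → ∀ p → Twin Γ (u p) (v p))
        (IM-twin Γ) stY (α-twinInvariant Γ)

theorem4 : ∀ {c ℓ} (F : Field c ℓ) →
    SchemeEquiv (WithField.IM F) (WithField.IMt F)
theorem4 F = IMt⪯IM F , IM⪯IMt F
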